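{- There is no distance-regular graph with intersection array $\{55,36,11;1,4,45\}$. That is, there is no finite connected simple undirected graph $\Gamma$ of diameter $3$ such that, for every $i\in\{0,1,2,3\}$ and every pair of vertices $x,y$ of $\Gamma$ at distance $i$, the number of neighbours of $y$ at distance $i+1$ from $x$ equals $b_i$ and the number of neighbours of $y$ at distance $i-1$ from $x$ equals $c_i$, where $(b_0,b_1,b_2,b_3)=(55,36,11,0)$ and $(c_0,c_1,c_2,c_3)=(0,1,4,45)$.
   Context: Graphs are finite, undirected, without loops or multiple edges; distance is the usual path-length distance. A connected graph $\Gamma$ of diameter $d$ is called distance-regular with intersection array $\{b_0,b_1,\ldots,b_{d-1};c_1,c_2,\ldots,c_d\}$ if for every $i\in\{0,\ldots,d\}$ and every pair of vertices $x,y$ at distance $i$, there are exactly $b_i$ neighbours of $y$ at distance $i+1$ from $x$ and exactly $c_i$ neighbours of $y$ at distance $i-1$ from $x$ (with the conventions $b_d=0$ and $c_0=0$; necessarily $c_1=1$). In particular such a graph is regular of degree $b_0$. -}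

module Defs where

open import Data.Fin using (Fin; toℕ)
open import Data.Fin.Subset using (Subset; _∈_; ∣_∣)
open import Data.Nat using (ℕ; zero; suc; _≤_; _<_)
open import Data.Product using (∃; ∃₂; _×_)
open import Data.Vec using (Vec; _∷_; _∷ʳ_; lookup)
open import Function.Bundles using (_⇔_)
open import Relation.Binary using (Irreflexive; Symmetric; Decidable)
open import Relation.Binary.PropositionalEquality using (_≡_)
open import Relation.Nullary using (¬_)

-- Decidability of adjacency is classically automatic.
record Graph : Set₁ where
  infix 4 _~_
  field
    order    : ℕ
    _~_      : Fin order → Fin order → Set
    ~-irrefl : Irreflexive _≡_ _~_
    ~-sym    : Symmetric _~_
    _~?_     : Decidable _~_

  Vertex : Set
  Vertex = Fin order

-- "Exactly m elements of Fin n satisfy P".  The set of these elements is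
-- presented as a Subset, so distinct proofs of P z are not counted separately.
HasCount : ∀ {n} → (Fin n → Set) → ℕ → Set
HasCount {n} P m = ∃ λ (S : Subset n) → (∀ z → z ∈ S ⇔ P z) × ∣ S ∣ ≡ m

module _ (Γ : Graph) where
  open Graph Γ

  data Walk : ℕ → Vertex → Vertex → Set where
    []  : ∀ {x} → Walk zero x x
    _∷_ : ∀ {k x y z} → x ~ y → Walk k y z → Walk (suc k) x z

  Connected : Set
  Connected = ∀ x y → ∃ λ k → Walk k x y

  Distance : Vertex → Vertex → ℕ → Set
  Distance x y k = Walk k x y × (∀ j → j < k → ¬ Walk j x y)

  -- The second component also forces Γ to have a vertex.
  Diameter : ℕ → Set
  Diameter d = (∀ x y → ∃ λ k → Distance x y k × k ≤ d)
             × (∃₂ λ x y → Distance x y d)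

  -- Intersection array {b₀,…,b_{d-1}; c₁,…,c_d}: the vector b is indexed from 0
  -- and c from 1, so b_d = 0 is appended to b and c₀ = 0 is prepended to c.
  record IsDistanceRegular {d : ℕ} (b c : Vec ℕ d) : Set where
    field
      connected : Connected
      diameter  : Diameter d
      b-count   : ∀ (i : Fin (suc d)) x y → Distance x y (toℕ i) →
                  HasCount (λ z → y ~ z × Distance x z (suc (toℕ i)))
                           (lookup (b ∷ʳ 0) i)
      -- "Distance i - 1" is read as a j with j + 1 = i; there is none for i = 0.
      c-count   : ∀ (i : Fin (suc d)) x y → Distance x y (toℕ i) →
                  HasCount (λ z → y ~ z × ∃ λ j → suc j ≡ toℕ i × Distance x z j)
                           (lookup (0 ∷ c) i)

{-# OPTIONS --safe #-}

-- Let Δ be the graph induced on the 55 neighbours of a vertex x.  It is 18-regular, and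
-- non-adjacent vertices of Δ have at most c₂ - 1 = 3 common neighbours in Δ.  Four pairwise
-- non-adjacent vertices would dominate at least 4 · 19 - 6 · 3 = 58 vertices of Δ, so there are
-- none.  Hence, for a coclique {a, b, c} of Δ, the vertices non-adjacent to two of its members
-- form three cliques, which miss at most 3 · 3 = 9 vertices.  These can be absorbed one by one:
-- a vertex with more than three neighbours in a clique is adjacent to all of it.  So Δ is a union
-- of three cliques, one of which, S, has at least 19 vertices.
--
-- Each of the vertices of S has b₁ = 36 neighbours at distance 2 from x, and no vertex at distance
-- 2 from x has two neighbours in S, because adjacent vertices have only 18 common neighbours.
-- So at least 19 · 36 = 684 vertices are at distance 2 from x, but there are 55 · 36 / 4 = 495.
module Submission where

open import Defs
open import Data.Bool using (true; false; if_then_else_; _∧_)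
open import Data.Empty using (⊥)
open import Data.Fin using (Fin; zero; suc; _≟_)
open import Data.Fin.Subset
  using (Subset; _∈_; _∉_; _⊆_; ∣_∣; _∪_; _∩_; _-_; ∁; ⁅_⁆; Nonempty)
open import Data.Fin.Subset.Properties
open import Data.Nat using (ℕ; zero; suc; _+_; _*_; _≤_; _<_; z≤n; s≤s; _<?_)
open import Data.Nat.Properties
  using (+-*-semiring; *-commutativeSemigroup; +-suc; +-identityʳ; +-mono-≤; +-monoˡ-≤; +-monoʳ-≤;
         +-cancelʳ-≤; +-cancelˡ-≤; +-cancelˡ-≡; *-monoʳ-≤; *-comm; *-identityˡ; suc-injective;
         m≤m+n; n≤1+n; m≤n⇒m≤1+n; ≤-refl; ≤-reflexive; ≤-trans; ≤-pred; <⇒≱; ≮⇒≥;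
         module ≤-Reasoning)
open import Data.Product using (∃; _×_; _,_; proj₁; proj₂)
open import Data.Sum using (_⊎_; inj₁; inj₂; [_,_]′)
open import Data.Vec using (_∷_; []; lookup; tabulate)
open import Data.Vec.Properties
  using (lookup∘tabulate; lookup-zipWith; []=⇒lookup; lookup⇒[]=)
open import Function using (_∘_)
open import Function.Bundles using (Equivalence)
open import Relation.Binary.PropositionalEquality
  using (_≡_; refl; sym; trans; cong; cong₂; subst; module ≡-Reasoning)
open import Relation.Nullary using (¬_; Dec; yes; no; does; contradiction; ¬?; _×-dec_)
open import Relation.Nullary.Decidable using (dec-true; decidable-stable)
open import Relation.Unary using (Pred; Decidable)
open import Level using (0ℓ)
open import Algebra.Properties.CommutativeSemigroup *-commutativeSemigroup using (x∙yz≈y∙xz)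
open import Algebra.Properties.Semiring.Sum +-*-semiring
  using (sum; sum-cong-≗; ∑-comm; *-distribˡ-sum)

private
  variable
    m n : ℕ

-- Cardinalities of subsets

∣∪∣+∣∩∣ : ∀ (p q : Subset n) → ∣ p ∪ q ∣ + ∣ p ∩ q ∣ ≡ ∣ p ∣ + ∣ q ∣
∣∪∣+∣∩∣ []          []          = refl
∣∪∣+∣∩∣ (false ∷ p) (false ∷ q) = ∣∪∣+∣∩∣ p q
∣∪∣+∣∩∣ (true ∷ p)  (false ∷ q) = cong suc (∣∪∣+∣∩∣ p q)
∣∪∣+∣∩∣ (false ∷ p) (true ∷ q)  = trans (cong suc (∣∪∣+∣∩∣ p q)) (sym (+-suc ∣ p ∣ ∣ q ∣))
∣∪∣+∣∩∣ (true ∷ p)  (true ∷ q)  = cong suc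
  (trans (+-suc ∣ p ∪ q ∣ ∣ p ∩ q ∣)
         (trans (cong suc (∣∪∣+∣∩∣ p q)) (sym (+-suc ∣ p ∣ ∣ q ∣))))

∣∪∣≤ : ∀ (p q : Subset n) → ∣ p ∪ q ∣ ≤ ∣ p ∣ + ∣ q ∣
∣∪∣≤ p q = ≤-trans (m≤m+n _ _) (≤-reflexive (∣∪∣+∣∩∣ p q))

-- Inclusion-exclusion from below, with the overlap `k` on the right so that no truncated
-- subtraction occurs. `no-4-coclique` iterates it.
∣∪∣≥ : ∀ (p q : Subset n) {a b k} → a ≤ ∣ p ∣ → b ≤ ∣ q ∣ → ∣ p ∩ q ∣ ≤ k →
       a + b ≤ ∣ p ∪ q ∣ + k
∣∪∣≥ p q {a} {b} {k} a≤p b≤q p∩q≤k = begin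
  a + b                    ≤⟨ +-mono-≤ a≤p b≤q ⟩
  ∣ p ∣ + ∣ q ∣            ≡⟨ ∣∪∣+∣∩∣ p q ⟨
  ∣ p ∪ q ∣ + ∣ p ∩ q ∣    ≤⟨ +-monoʳ-≤ ∣ p ∪ q ∣ p∩q≤k ⟩
  ∣ p ∪ q ∣ + k            ∎
  where open ≤-Reasoning

empty⇒∣∣≤0 : ∀ {p : Subset n} → (∀ {x} → x ∉ p) → ∣ p ∣ ≤ 0
empty⇒∣∣≤0 {n} x∉p =
  subst (λ q → ∣ q ∣ ≤ 0) (sym (Empty-unique (λ (_ , x∈p) → x∉p x∈p))) (≤-reflexive (∣⊥∣≡0 n))

∣∣>0⇒nonempty : ∀ (p : Subset n) → 0 < ∣ p ∣ → Nonempty p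
∣∣>0⇒nonempty p 0<∣p∣ = decidable-stable (nonempty? p)
  λ p-empty → <⇒≱ 0<∣p∣ (empty⇒∣∣≤0 (λ x∈p → p-empty (_ , x∈p)))

∣disjoint-∪∣ : ∀ (p q : Subset n) → (∀ {x} → x ∈ p → x ∉ q) → ∣ p ∪ q ∣ ≡ ∣ p ∣ + ∣ q ∣
∣disjoint-∪∣ {n} p q disjoint = begin
  ∣ p ∪ q ∣                ≡⟨ +-identityʳ _ ⟨
  ∣ p ∪ q ∣ + 0            ≡⟨ cong (∣ p ∪ q ∣ +_) ∣p∩q∣≡0 ⟨
  ∣ p ∪ q ∣ + ∣ p ∩ q ∣    ≡⟨ ∣∪∣+∣∩∣ p q ⟩
  ∣ p ∣ + ∣ q ∣            ∎
  where
  open ≡-Reasoning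
  ∣p∩q∣≡0 : ∣ p ∩ q ∣ ≡ 0
  ∣p∩q∣≡0 = trans
    (cong ∣_∣ (Empty-unique (λ (_ , x∈) → let x∈p , x∈q = x∈p∩q⁻ p q x∈ in disjoint x∈p x∈q)))
    (∣⊥∣≡0 n)

∣⁅x⁆∪p∣ : ∀ {x} {p : Subset n} → x ∉ p → ∣ ⁅ x ⁆ ∪ p ∣ ≡ suc ∣ p ∣
∣⁅x⁆∪p∣ {x = x} {p} x∉p = trans
  (∣disjoint-∪∣ ⁅ x ⁆ p (λ y∈⁅x⁆ → subst (_∉ p) (sym (x∈⁅y⁆⇒x≡y x y∈⁅x⁆)) x∉p))
  (cong (_+ ∣ p ∣) (∣⁅x⁆∣≡1 x))

subsingleton⇒∣∣≤1 : ∀ (p : Subset n) → (∀ {x y} → x ∈ p → y ∈ p → x ≡ y) → ∣ p ∣ ≤ 1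
subsingleton⇒∣∣≤1 p prop with nonempty? p
... | yes (x , x∈p) = ≤-trans
  (p⊆q⇒∣p∣≤∣q∣ (λ y∈p → subst (_∈ ⁅ x ⁆) (prop x∈p y∈p) (x∈⁅x⁆ x))) (≤-reflexive (∣⁅x⁆∣≡1 x))
... | no p-empty = ≤-trans (empty⇒∣∣≤0 (λ x∈p → p-empty (_ , x∈p))) z≤n

∣cover₂∣ : ∀ {p q r : Subset n} → (∀ {x} → x ∈ p → x ∈ q ⊎ x ∈ r) → ∣ p ∣ ≤ ∣ q ∣ + ∣ r ∣
∣cover₂∣ {q = q} {r} cover = ≤-trans (p⊆q⇒∣p∣≤∣q∣ (x∈p∪q⁺ ∘ cover)) (∣∪∣≤ q r)

∣cover₄∣ : ∀ {p q r s t : Subset n} → (∀ {x} → x ∈ p → x ∈ q ⊎ x ∈ r ⊎ x ∈ s ⊎ x ∈ t) →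
           ∣ p ∣ ≤ ∣ q ∣ + (∣ r ∣ + (∣ s ∣ + ∣ t ∣))
∣cover₄∣ {q = q} {r} {s} {t} cover = ≤-trans
  (∣cover₂∣ {q = q} {r = r ∪ (s ∪ t)} (λ x∈p → lift (cover x∈p)))
  (+-monoʳ-≤ ∣ q ∣ (≤-trans (∣∪∣≤ r (s ∪ t)) (+-monoʳ-≤ ∣ r ∣ (∣∪∣≤ s t))))
  where
  lift : ∀ {x} → x ∈ q ⊎ x ∈ r ⊎ x ∈ s ⊎ x ∈ t → x ∈ q ⊎ x ∈ r ∪ (s ∪ t)
  lift (inj₁ x∈q)        = inj₁ x∈q
  lift (inj₂ (inj₁ x∈r)) = inj₂ (x∈p∪q⁺ (inj₁ x∈r))
  lift (inj₂ (inj₂ x∈))  = inj₂ (x∈p∪q⁺ {p = r} (inj₂ (x∈p∪q⁺ x∈)))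

pigeonhole₃ : ∀ m {a b c} → 3 * m < a + (b + c) → m < a ⊎ m < b ⊎ m < c
pigeonhole₃ m {a} {b} {c} 3m< with m <? a | m <? b | m <? c
... | yes m<a | _       | _       = inj₁ m<a
... | no _    | yes m<b | _       = inj₂ (inj₁ m<b)
... | no _    | no _    | yes m<c = inj₂ (inj₂ m<c)
... | no m≮a  | no m≮b  | no m≮c  = contradiction
  -- `3 * m` unfolds to `m + (m + (m + 0))`, which is why the last summand is compared with `m + 0`.
  (+-mono-≤ (≮⇒≥ m≮a) (+-mono-≤ (≮⇒≥ m≮b) (≤-trans (≮⇒≥ m≮c) (m≤m+n m 0)))) (<⇒≱ 3m<)

comprehension : {P : Pred (Fin n) 0ℓ} → Decidable P → Subset n
comprehension P? = tabulate (does ∘ P?)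

∈-comprehension⁺ : {P : Pred (Fin n) 0ℓ} (P? : Decidable P) → ∀ {x} → P x → x ∈ comprehension P?
∈-comprehension⁺ P? {x} Px =
  lookup⇒[]= x _ (trans (lookup∘tabulate (does ∘ P?) x) (dec-true (P? x) Px))

∈-comprehension⁻ : {P : Pred (Fin n) 0ℓ} (P? : Decidable P) → ∀ {x} → x ∈ comprehension P? → P x
∈-comprehension⁻ P? {x} x∈ with P? x | trans (sym (lookup∘tabulate (does ∘ P?) x)) ([]=⇒lookup x∈)
... | yes Px | _  = Px
... | no _   | ()

-- Double counting

indicator : Subset n → Fin n → ℕ
indicator p x = if lookup p x then 1 else 0

∣∣≡sum : ∀ (p : Subset n) → ∣ p ∣ ≡ sum (indicator p)
∣∣≡sum []          = refl
∣∣≡sum (true ∷ p)  = cong suc (∣∣≡sum p)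
∣∣≡sum (false ∷ p) = ∣∣≡sum p

indicator-∩ : ∀ (p q : Subset n) x → indicator (p ∩ q) x ≡ indicator p x * indicator q x
indicator-∩ p q x rewrite lookup-zipWith _∧_ x p q with lookup p x | lookup q x
... | true  | true  = refl
... | true  | false = refl
... | false | _     = refl

*∣∩∣≡sum : ∀ k (p q : Subset n) →
            k * ∣ p ∩ q ∣ ≡ sum (λ x → k * (indicator p x * indicator q x))
*∣∩∣≡sum k p q = trans
  (cong (k *_) (trans (∣∣≡sum (p ∩ q)) (sum-cong-≗ (indicator-∩ p q))))
  (*-distribˡ-sum k (λ x → indicator p x * indicator q x))

sum-mono-≤ : ∀ {f g : Fin n → ℕ} → (∀ i → f i ≤ g i) → sum f ≤ sum g
sum-mono-≤ {zero}  f≤g = z≤n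
sum-mono-≤ {suc n} f≤g = +-mono-≤ (f≤g zero) (sum-mono-≤ (f≤g ∘ suc))

module _ (R : Fin m → Subset n) (Rᵒ : Fin n → Subset m)
         (R⇒Rᵒ : ∀ {x y} → y ∈ R x → x ∈ Rᵒ y) (Rᵒ⇒R : ∀ {x y} → x ∈ Rᵒ y → y ∈ R x) where

  lookup-converse : ∀ x y → lookup (R x) y ≡ lookup (Rᵒ y) x
  lookup-converse x y with lookup (R x) y in eq | lookup (Rᵒ y) x in eqᵒ
  ... | true  | true  = refl
  ... | false | false = refl
  ... | true  | false with () ← trans (sym eqᵒ) ([]=⇒lookup (R⇒Rᵒ (lookup⇒[]= y (R x) eq)))
  ... | false | true  with () ← trans (sym eq) ([]=⇒lookup (Rᵒ⇒R (lookup⇒[]= x (Rᵒ y) eqᵒ)))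

  -- Both sides bound the number of related pairs in `p` × `q`, written as a double sum of products
  -- of indicators whose order `∑-comm` exchanges. Off `p` and off `q` the indicator vanishes, so
  -- the bounds `k` and `l` are only asked for on these sets.
  double-counting : ∀ {k l} (p : Subset m) (q : Subset n) →
                    (∀ {x} → x ∈ p → k ≤ ∣ q ∩ R x ∣) → (∀ {y} → y ∈ q → ∣ p ∩ Rᵒ y ∣ ≤ l) →
                    k * ∣ p ∣ ≤ l * ∣ q ∣
  double-counting {k} {l} p q lower upper = begin
    k * ∣ p ∣
      ≡⟨ cong (k *_) (∣∣≡sum p) ⟩
    k * sum (indicator p)
      ≡⟨ *-distribˡ-sum k (indicator p) ⟩
    sum (λ x → k * indicator p x)
      ≤⟨ sum-mono-≤ lower′ ⟩
    sum (λ x → indicator p x * ∣ q ∩ R x ∣)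
      ≡⟨ sum-cong-≗ (λ x → *∣∩∣≡sum (indicator p x) q (R x)) ⟩
    sum (λ x → sum (λ y → indicator p x * (indicator q y * indicator (R x) y)))
      ≡⟨ ∑-comm (λ x y → indicator p x * (indicator q y * indicator (R x) y)) ⟩
    sum (λ y → sum (λ x → indicator p x * (indicator q y * indicator (R x) y)))
      ≡⟨ sum-cong-≗ (λ y → trans (sum-cong-≗ (λ x → rearrange x y))
                                  (sym (*∣∩∣≡sum (indicator q y) p (Rᵒ y)))) ⟩
    sum (λ y → indicator q y * ∣ p ∩ Rᵒ y ∣)
      ≤⟨ sum-mono-≤ upper′ ⟩
    sum (λ y → l * indicator q y)
      ≡⟨ *-distribˡ-sum l (indicator q) ⟨
    l * sum (indicator q)
      ≡⟨ cong (l *_) (∣∣≡sum q) ⟨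
    l * ∣ q ∣ ∎
    where
    open ≤-Reasoning
    rearrange : ∀ x y → indicator p x * (indicator q y * indicator (R x) y) ≡
                        indicator q y * (indicator p x * indicator (Rᵒ y) x)
    rearrange x y rewrite lookup-converse x y =
      x∙yz≈y∙xz (indicator p x) (indicator q y) (indicator (Rᵒ y) x)
    lower′ : ∀ x → k * indicator p x ≤ indicator p x * ∣ q ∩ R x ∣
    lower′ x with lookup p x in eq
    ... | true  = subst (_≤ 1 * ∣ q ∩ R x ∣) (*-comm 1 k)
                    (*-monoʳ-≤ 1 (lower (lookup⇒[]= x p eq)))
    ... | false = ≤-reflexive (*-comm k 0)
    upper′ : ∀ y → indicator q y * ∣ p ∩ Rᵒ y ∣ ≤ l * indicator q y
    upper′ y with lookup q y in eq
    ... | true  = subst (1 * ∣ p ∩ Rᵒ y ∣ ≤_) (*-comm 1 l)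
                    (*-monoʳ-≤ 1 (upper (lookup⇒[]= y q eq)))
    ... | false = z≤n

-- Large cliques in an 18-regular graph on 55 vertices

-- N y is the closed neighbourhood of y in a graph on P.
module LocalGraph
  (P : Subset n) (N : Fin n → Subset n)
  (N⊆P : ∀ y → N y ⊆ P)
  (N-refl : ∀ {y} → y ∈ P → y ∈ N y)
  (N-sym : ∀ {y z} → y ∈ P → z ∈ N y → y ∈ N z)
  (∣P∣≡55 : ∣ P ∣ ≡ 55)
  (∣N∣≡19 : ∀ {y} → y ∈ P → ∣ N y ∣ ≡ 19)
  (∣N∩N∣≤3 : ∀ {y z} → y ∈ P → z ∈ P → z ∉ N y → ∣ N y ∩ N z ∣ ≤ 3)
  where

  Clique : Subset n → Set
  Clique S = S ⊆ P × (∀ {y z} → y ∈ S → z ∈ S → z ∈ N y)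

  -- The closed neighbourhoods are joined one at a time. Each new one has 19 elements and meets
  -- every earlier one in at most 3, so the union grows at least to 19 + 19 - 3 = 35, then 35 + 19 -
  -- 6 = 48, then 48 + 19 - 9 = 58, exceeding the 55 vertices of `P`.
  no-4-coclique : ∀ {a b c d} → a ∈ P → b ∈ P → c ∈ P → d ∈ P →
                  b ∉ N a → c ∉ N a → c ∉ N b → d ∉ N a → d ∉ N b → d ∉ N c → ⊥
  no-4-coclique {a} {b} {c} {d} a∈P b∈P c∈P d∈P b≁a c≁a c≁b d≁a d≁b d≁c =
    <⇒≱ (m≤m+n 56 2) (begin
      58                                   ≤⟨ +-cancelʳ-≤ 9 58 _ step₄ ⟩
      ∣ ((N a ∪ N b) ∪ N c) ∪ N d ∣        ≤⟨ p⊆q⇒∣p∣≤∣q∣ union⊆P ⟩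
      ∣ P ∣                                ≡⟨ ∣P∣≡55 ⟩
      55                                   ∎)
    where
    open ≤-Reasoning
    size : ∀ {y} → y ∈ P → 19 ≤ ∣ N y ∣
    size y∈P = ≤-reflexive (sym (∣N∣≡19 y∈P))
    ∩-bound : ∀ (p q r : Subset n) {k l} → ∣ p ∩ r ∣ ≤ k → ∣ q ∩ r ∣ ≤ l → ∣ (p ∪ q) ∩ r ∣ ≤ k + l
    ∩-bound p q r p∩r≤k q∩r≤l = subst (λ s → ∣ s ∣ ≤ _) (sym (∩-distribʳ-∪ r p q))
      (≤-trans (∣∪∣≤ (p ∩ r) (q ∩ r)) (+-mono-≤ p∩r≤k q∩r≤l))
    step₂ : 35 + 3 ≤ ∣ N a ∪ N b ∣ + 3
    step₂ = ∣∪∣≥ (N a) (N b) (size a∈P) (size b∈P) (∣N∩N∣≤3 a∈P b∈P b≁a)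
    step₃ : 48 + 6 ≤ ∣ (N a ∪ N b) ∪ N c ∣ + 6
    step₃ = ∣∪∣≥ (N a ∪ N b) (N c) (+-cancelʳ-≤ 3 35 _ step₂) (size c∈P)
      (∩-bound (N a) (N b) (N c) (∣N∩N∣≤3 a∈P c∈P c≁a) (∣N∩N∣≤3 b∈P c∈P c≁b))
    step₄ : 58 + 9 ≤ ∣ ((N a ∪ N b) ∪ N c) ∪ N d ∣ + 9
    step₄ = ∣∪∣≥ ((N a ∪ N b) ∪ N c) (N d) (+-cancelʳ-≤ 6 48 _ step₃) (size d∈P)
      (∩-bound (N a ∪ N b) (N c) (N d)
        (∩-bound (N a) (N b) (N d) (∣N∩N∣≤3 a∈P d∈P d≁a) (∣N∩N∣≤3 b∈P d∈P d≁b))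
        (∣N∩N∣≤3 c∈P d∈P d≁c))
    union⊆P : ((N a ∪ N b) ∪ N c) ∪ N d ⊆ P
    union⊆P x∈ with x∈p∪q⁻ ((N a ∪ N b) ∪ N c) (N d) x∈
    ... | inj₂ x∈d = N⊆P d x∈d
    ... | inj₁ x∈abc with x∈p∪q⁻ (N a ∪ N b) (N c) x∈abc
    ... | inj₂ x∈c = N⊆P c x∈c
    ... | inj₁ x∈ab = [ N⊆P a , N⊆P b ]′ (x∈p∪q⁻ (N a) (N b) x∈ab)

  outside : Fin n → Fin n → Subset n
  outside a b = P ∩ ∁ (N a ∪ N b)

  ∈-outside⁺ : ∀ {a b z} → z ∈ P → z ∉ N a → z ∉ N b → z ∈ outside a b
  ∈-outside⁺ {a} {b} z∈P z≁a z≁b =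
    x∈p∩q⁺ (z∈P , x∉p⇒x∈∁p (λ z∈ → [ z≁a , z≁b ]′ (x∈p∪q⁻ (N a) (N b) z∈)))

  ∈-outside⁻ : ∀ {a b z} → z ∈ outside a b → z ∈ P × z ∉ N a × z ∉ N b
  ∈-outside⁻ {a} {b} z∈ with x∈p∩q⁻ P (∁ (N a ∪ N b)) z∈
  ... | z∈P , z∈∁ = z∈P , x∈∁p⇒x∉p z∈∁ ∘ x∈p∪q⁺ ∘ inj₁
                        , x∈∁p⇒x∉p z∈∁ ∘ x∈p∪q⁺ {p = N a} ∘ inj₂

  -- Two non-adjacent vertices outside both neighbourhoods would complete `a`, `b` to a coclique of
  -- size four.
  outside-clique : ∀ {a b} → a ∈ P → b ∈ P → b ∉ N a → Clique (outside a b)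
  outside-clique a∈P b∈P b≁a = proj₁ ∘ ∈-outside⁻ , adjacent
    where
    adjacent : ∀ {y z} → y ∈ outside _ _ → z ∈ outside _ _ → z ∈ N y
    adjacent {y} {z} y∈ z∈ with ∈-outside⁻ y∈ | ∈-outside⁻ z∈
    ... | y∈P , y≁a , y≁b | z∈P , z≁a , z≁b = decidable-stable (z ∈? N y)
      (no-4-coclique a∈P b∈P y∈P z∈P b≁a y≁a y≁b z≁a z≁b)

  -- Two closed neighbourhoods cover at most 38 of the 55 vertices. The case of equal `a` and `b` is
  -- included.
  outside-nonempty : ∀ {a b} → a ∈ P → b ∈ P → Nonempty (outside a b)
  outside-nonempty {a} {b} a∈P b∈P = ∣∣>0⇒nonempty (outside a b) (+-cancelˡ-≤ 38 1 _ (begin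
    39                                   ≤⟨ m≤m+n 39 16 ⟩
    55                                   ≡⟨ ∣P∣≡55 ⟨
    ∣ P ∣                                ≤⟨ ∣cover₂∣ {p = P} cover ⟩
    ∣ N a ∪ N b ∣ + ∣ outside a b ∣      ≤⟨ +-monoˡ-≤ _ (∣∪∣≤ (N a) (N b)) ⟩
    ∣ N a ∣ + ∣ N b ∣ + ∣ outside a b ∣  ≡⟨ cong (_+ ∣ outside a b ∣)
                                              (cong₂ _+_ (∣N∣≡19 a∈P) (∣N∣≡19 b∈P)) ⟩
    38 + ∣ outside a b ∣                 ∎))
    where
    open ≤-Reasoning
    cover : ∀ {z} → z ∈ P → z ∈ N a ∪ N b ⊎ z ∈ outside a b
    cover {z} z∈P with z ∈? N a ∪ N b
    ... | yes z∈ = inj₁ z∈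
    ... | no  z∉ = inj₂ (x∈p∩q⁺ (z∈P , x∉p⇒x∈∁p z∉))

  Coclique₃ : Set
  Coclique₃ = ∃ λ a → ∃ λ b → ∃ λ c → a ∈ P × b ∈ P × c ∈ P × b ∉ N a × c ∉ N a × c ∉ N b

  coclique₃ : Coclique₃
  coclique₃ with ∣∣>0⇒nonempty P (subst (0 <_) (sym ∣P∣≡55) (s≤s z≤n))
  -- The coclique is chosen greedily; taking `a` twice gives a vertex `b` outside `N a`, and then
  -- `c` is taken outside `N a` and `N b`.
  ... | a , a∈P with outside-nonempty a∈P a∈P
  ... | b , b∈ with ∈-outside⁻ b∈
  ... | b∈P , b≁a , _ with outside-nonempty a∈P b∈P
  ... | c , c∈ with ∈-outside⁻ c∈
  ... | c∈P , c≁a , c≁b = a , b , c , a∈P , b∈P , c∈P , b≁a , c≁a , c≁b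

  insert-clique : ∀ {r A} → r ∈ P → Clique A → A ⊆ N r → Clique (A ∪ ⁅ r ⁆)
  insert-clique {r} {A} r∈P (A⊆P , A-adj) full = ⊆P , adjacent
    where
    member : ∀ {z} → z ∈ A ∪ ⁅ r ⁆ → z ∈ A ⊎ z ≡ r
    member z∈ = [ inj₁ , inj₂ ∘ x∈⁅y⁆⇒x≡y r ]′ (x∈p∪q⁻ A ⁅ r ⁆ z∈)
    ⊆P : A ∪ ⁅ r ⁆ ⊆ P
    ⊆P z∈ with member z∈
    ... | inj₁ z∈A  = A⊆P z∈A
    ... | inj₂ refl = r∈P
    adjacent : ∀ {y z} → y ∈ A ∪ ⁅ r ⁆ → z ∈ A ∪ ⁅ r ⁆ → z ∈ N y
    adjacent y∈ z∈ with member y∈ | member z∈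
    ... | inj₁ y∈A  | inj₁ z∈A  = A-adj y∈A z∈A
    ... | inj₁ y∈A  | inj₂ refl = N-sym r∈P (full y∈A)
    ... | inj₂ refl | inj₁ z∈A  = full z∈A
    ... | inj₂ refl | inj₂ refl = N-refl r∈P

  -- A vertex s ∈ A missing from N r would have all of A ∩ N r in common with r.
  ∣A∩N∣>3⇒A⊆N : ∀ {r A} → r ∈ P → Clique A → 3 < ∣ A ∩ N r ∣ → A ⊆ N r
  ∣A∩N∣>3⇒A⊆N {r} {A} r∈P (A⊆P , A-adj) 3< {s} s∈A = decidable-stable (s ∈? N r) λ s≁r →
    <⇒≱ 3< (≤-trans (p⊆q⇒∣p∣≤∣q∣ common) (∣N∩N∣≤3 r∈P (A⊆P s∈A) s≁r))
    where
    common : A ∩ N r ⊆ N r ∩ N s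
    common x∈ with x∈p∩q⁻ A (N r) x∈
    ... | x∈A , x∈Nr = x∈p∩q⁺ (x∈Nr , A-adj s∈A x∈A)

  -- Absorbing the leftover vertices into three cliques

  LargeClique : Set
  LargeClique = ∃ λ S → Clique S × 19 ≤ ∣ S ∣

  -- `U` holds the vertices still to be absorbed. The four sets may overlap, because the cover only
  -- serves to bound cardinalities from above.
  Covered : Subset n → Subset n → Subset n → Subset n → Set
  Covered U A B C = ∀ {z} → z ∈ P → z ∈ U ⊎ z ∈ A ⊎ z ∈ B ⊎ z ∈ C

  -- By this symmetry `absorb-by` only has to extend the first of the three cliques.
  rotate : ∀ {U A B C} → Covered U A B C → Covered U B C A
  rotate cover z∈P with cover z∈P
  ... | inj₁ z∈U               = inj₁ z∈U
  ... | inj₂ (inj₁ z∈A)        = inj₂ (inj₂ (inj₂ z∈A))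
  ... | inj₂ (inj₂ (inj₁ z∈B)) = inj₂ (inj₁ z∈B)
  ... | inj₂ (inj₂ (inj₂ z∈C)) = inj₂ (inj₂ (inj₁ z∈C))

  -- A vertex of U has 19 > 9 + 3 · 3 closed neighbours, hence more than three in one of the
  -- cliques, which it therefore extends.  When U is exhausted, 55 > 3 · 18 applies.
  absorb : ∀ m {U A B C} → m ≤ 9 → ∣ U ∣ ≤ m → U ⊆ P → Clique A → Clique B → Clique C →
           Covered U A B C → LargeClique
  absorb-by : ∀ m {U A B C r} → m ≤ 8 → ∣ U ∣ ≤ suc m → U ⊆ P → r ∈ U → 3 < ∣ A ∩ N r ∣ →
              Clique A → Clique B → Clique C → Covered U A B C → LargeClique

  absorb zero {U} {A} {B} {C} _ ∣U∣≤0 U⊆P clA clB clC cover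
    with pigeonhole₃ 18 (≤-trans (≤-reflexive (sym ∣P∣≡55))
           (≤-trans (∣cover₄∣ {p = P} cover) (+-monoˡ-≤ _ ∣U∣≤0)))
  -- `18 < ∣ A ∣` unfolds to `19 ≤ ∣ A ∣`, the bound in `LargeClique`.
  ... | inj₁ 18<A        = A , clA , 18<A
  ... | inj₂ (inj₁ 18<B) = B , clB , 18<B
  ... | inj₂ (inj₂ 18<C) = C , clC , 18<C
  absorb (suc m) {U} {A} {B} {C} m<9 ∣U∣≤ U⊆P clA clB clC cover with nonempty? U
  -- `m` is only an upper bound for `∣ U ∣`, so `U` may be exhausted early; the recursion then
  -- merely lowers `m` to zero.
  ... | no U-empty = absorb m (≤-trans (n≤1+n m) m<9)
          (≤-trans (empty⇒∣∣≤0 (λ x∈U → U-empty (_ , x∈U))) z≤n) U⊆P clA clB clC cover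
  ... | yes (r , r∈U) with pigeonhole₃ 3 (+-cancelˡ-≤ 9 10 _ (begin
          19                                                    ≡⟨ ∣N∣≡19 (U⊆P r∈U) ⟨
          ∣ N r ∣                                               ≤⟨ ∣cover₄∣ {p = N r} cover′ ⟩
          ∣ U ∣ + (∣ A ∩ N r ∣ + (∣ B ∩ N r ∣ + ∣ C ∩ N r ∣))   ≤⟨ +-monoˡ-≤ _ (≤-trans ∣U∣≤ m<9) ⟩
          9 + (∣ A ∩ N r ∣ + (∣ B ∩ N r ∣ + ∣ C ∩ N r ∣))       ∎))
    where
    open ≤-Reasoning
    cover′ : ∀ {z} → z ∈ N r → z ∈ U ⊎ z ∈ A ∩ N r ⊎ z ∈ B ∩ N r ⊎ z ∈ C ∩ N r
    cover′ z∈N with cover (N⊆P r z∈N)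
    ... | inj₁ z∈U               = inj₁ z∈U
    ... | inj₂ (inj₁ z∈A)        = inj₂ (inj₁ (x∈p∩q⁺ (z∈A , z∈N)))
    ... | inj₂ (inj₂ (inj₁ z∈B)) = inj₂ (inj₂ (inj₁ (x∈p∩q⁺ (z∈B , z∈N))))
    ... | inj₂ (inj₂ (inj₂ z∈C)) = inj₂ (inj₂ (inj₂ (x∈p∩q⁺ (z∈C , z∈N))))
  ... | inj₁ 3<A        = absorb-by m (≤-pred m<9) ∣U∣≤ U⊆P r∈U 3<A clA clB clC cover
  ... | inj₂ (inj₁ 3<B) = absorb-by m (≤-pred m<9) ∣U∣≤ U⊆P r∈U 3<B clB clC clA (rotate cover)
  ... | inj₂ (inj₂ 3<C) = absorb-by m (≤-pred m<9) ∣U∣≤ U⊆P r∈U 3<C clC clA clB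
                            (rotate (rotate cover))

  absorb-by m {U} {A} {B} {C} {r} m≤8 ∣U∣≤ U⊆P r∈U 3<A clA clB clC cover =
    absorb m (m≤n⇒m≤1+n m≤8) (≤-pred (≤-trans (x∈p⇒∣p-x∣<∣p∣ r∈U) ∣U∣≤))
      (U⊆P ∘ p─q⊆p U ⁅ r ⁆)
      (insert-clique (U⊆P r∈U) clA (∣A∩N∣>3⇒A⊆N (U⊆P r∈U) clA 3<A)) clB clC cover′
    where
    cover′ : Covered (U - r) (A ∪ ⁅ r ⁆) B C
    cover′ {z} z∈P with z ≟ r | cover z∈P
    ... | yes refl | _               = inj₂ (inj₁ (x∈p∪q⁺ {p = A} (inj₂ (x∈⁅x⁆ r))))
    ... | no z≢r   | inj₁ z∈U        = inj₁ (x∈p∧x≢y⇒x∈p-y z∈U z≢r)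
    ... | no _     | inj₂ (inj₁ z∈A) = inj₂ (inj₁ (x∈p∪q⁺ (inj₁ z∈A)))
    ... | no _     | inj₂ (inj₂ z∈)  = inj₂ (inj₂ z∈)

  coclique₃⇒large-clique : Coclique₃ → LargeClique
  coclique₃⇒large-clique (a , b , c , a∈P , b∈P , c∈P , b≁a , c≁a , c≁b) =
    absorb 9 {R} {outside b c} {outside a c} {outside a b} ≤-refl ∣R∣≤9 R⊆P
      (outside-clique b∈P c∈P c≁b) (outside-clique a∈P c∈P c≁a) (outside-clique a∈P b∈P b≁a) cover
    where
    -- `R` consists of the vertices in at least two of the three closed neighbourhoods. Any other
    -- vertex of `P` avoids two of them and hence lies in one of the three cliques.
    R : Subset n
    R = (N a ∩ N b) ∪ ((N a ∩ N c) ∪ (N b ∩ N c))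
    ∣R∣≤9 : ∣ R ∣ ≤ 9
    ∣R∣≤9 = ≤-trans (∣∪∣≤ (N a ∩ N b) ((N a ∩ N c) ∪ (N b ∩ N c))) (+-mono-≤ (∣N∩N∣≤3 a∈P b∈P b≁a)
      (≤-trans (∣∪∣≤ (N a ∩ N c) (N b ∩ N c)) (+-mono-≤ (∣N∩N∣≤3 a∈P c∈P c≁a) (∣N∩N∣≤3 b∈P c∈P c≁b))))
    R⊆P : R ⊆ P
    R⊆P z∈ with x∈p∪q⁻ (N a ∩ N b) ((N a ∩ N c) ∪ (N b ∩ N c)) z∈
    ... | inj₁ z∈ab = N⊆P a (p∩q⊆p (N a) (N b) z∈ab)
    ... | inj₂ z∈′ = [ N⊆P a ∘ p∩q⊆p (N a) (N c) , N⊆P b ∘ p∩q⊆p (N b) (N c) ]′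
                       (x∈p∪q⁻ (N a ∩ N c) (N b ∩ N c) z∈′)
    cover : Covered R (outside b c) (outside a c) (outside a b)
    cover {z} z∈P with z ∈? N a | z ∈? N b | z ∈? N c
    ... | yes z~a | yes z~b | _       = inj₁ (x∈p∪q⁺ (inj₁ (x∈p∩q⁺ (z~a , z~b))))
    ... | yes z~a | no _    | yes z~c =
      inj₁ (x∈p∪q⁺ {p = N a ∩ N b} (inj₂ (x∈p∪q⁺ (inj₁ (x∈p∩q⁺ (z~a , z~c))))))
    ... | no _    | yes z~b | yes z~c =
      inj₁ (x∈p∪q⁺ {p = N a ∩ N b} (inj₂ (x∈p∪q⁺ {p = N a ∩ N c} (inj₂ (x∈p∩q⁺ (z~b , z~c))))))
    ... | _       | no z≁b  | no z≁c  = inj₂ (inj₁ (∈-outside⁺ z∈P z≁b z≁c))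
    ... | no z≁a  | yes _   | no z≁c  = inj₂ (inj₂ (inj₁ (∈-outside⁺ z∈P z≁a z≁c)))
    ... | no z≁a  | no z≁b  | yes _   = inj₂ (inj₂ (inj₂ (∈-outside⁺ z∈P z≁a z≁b)))

  large-clique : LargeClique
  large-clique = coclique₃⇒large-clique coclique₃

-- Cardinalities forced by the intersection array

HasCount⇒∣∣≡ : ∀ {P : Fin n → Set} {m} → HasCount P m → (p : Subset n) →
               (∀ {z} → z ∈ p → P z) → (∀ {z} → P z → z ∈ p) → ∣ p ∣ ≡ m
HasCount⇒∣∣≡ (S , S⇔P , ∣S∣≡m) p p⇒P P⇒p = trans
  -- Subsets with the same members are equal, so the witness `S` of `HasCount` may be exchanged for
  -- any convenient description `p`.
  (cong ∣_∣ (⊆-antisym (λ z∈p → Equivalence.from (S⇔P _) (p⇒P z∈p))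
                       (λ z∈S → P⇒p (Equivalence.to (S⇔P _) z∈S))))
  ∣S∣≡m

module _ (Γ : Graph)
         (isDistanceRegular : IsDistanceRegular Γ (55 ∷ 36 ∷ 11 ∷ []) (1 ∷ 4 ∷ 45 ∷ [])) where
  open Graph Γ
  open IsDistanceRegular isDistanceRegular

  distance₀ : ∀ {x} → Distance Γ x x 0
  distance₀ = [] , λ _ ()

  distance₁ : ∀ {x y} → x ~ y → Distance Γ x y 1
  distance₁ x~y = (x~y ∷ []) , λ { zero _ [] → ~-irrefl refl x~y ; (suc j) (s≤s ()) _ }

  distance₁⁻ : ∀ {x y} → Distance Γ x y 1 → x ~ y
  distance₁⁻ (x~y ∷ [] , _) = x~y

  Γ₁ : Vertex → Subset order
  Γ₁ x = comprehension (x ~?_)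

  ~⇒∈ : ∀ {x y} → x ~ y → y ∈ Γ₁ x
  ~⇒∈ {x} = ∈-comprehension⁺ (x ~?_)

  ∈⇒~ : ∀ {x y} → y ∈ Γ₁ x → x ~ y
  ∈⇒~ {x} = ∈-comprehension⁻ (x ~?_)

  Γ₁-sym : ∀ {x y} → y ∈ Γ₁ x → x ∈ Γ₁ y
  Γ₁-sym = ~⇒∈ ∘ ~-sym ∘ ∈⇒~

  x∉Γ₁x : ∀ {x} → x ∉ Γ₁ x
  x∉Γ₁x = ~-irrefl refl ∘ ∈⇒~

  Γ₁[_] : Vertex → Subset order
  Γ₁[ x ] = ⁅ x ⁆ ∪ Γ₁ x

  x∈Γ₁[x] : ∀ {x} → x ∈ Γ₁[ x ]
  x∈Γ₁[x] {x} = x∈p∪q⁺ (inj₁ (x∈⁅x⁆ x))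

  Γ₁⊆Γ₁[] : ∀ {x} → Γ₁ x ⊆ Γ₁[ x ]
  Γ₁⊆Γ₁[] {x} = x∈p∪q⁺ {p = ⁅ x ⁆} ∘ inj₂

  ∈Γ₁[]⁻ : ∀ {x y} → y ∈ Γ₁[ x ] → y ≡ x ⊎ y ∈ Γ₁ x
  ∈Γ₁[]⁻ {x} y∈ = [ inj₁ ∘ x∈⁅y⁆⇒x≡y x , inj₂ ]′ (x∈p∪q⁻ ⁅ x ⁆ (Γ₁ x) y∈)

  Γ₁[]-sym : ∀ {x y} → y ∈ Γ₁[ x ] → x ∈ Γ₁[ y ]
  Γ₁[]-sym y∈ with ∈Γ₁[]⁻ y∈
  ... | inj₁ refl = x∈Γ₁[x]
  ... | inj₂ y∈Γ₁ = Γ₁⊆Γ₁[] (Γ₁-sym y∈Γ₁)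

  -- Distance 2 expressed without walks, which makes it decidable and lets `Γ₂` be a `Subset`.
  -- `distance₂` and `distance₂⁻` show the agreement with `Distance`.
  IsSecond : Vertex → Vertex → Set
  IsSecond x z = z ∉ Γ₁[ x ] × Nonempty (Γ₁ x ∩ Γ₁ z)

  isSecond? : ∀ x z → Dec (IsSecond x z)
  isSecond? x z = ¬? (z ∈? Γ₁[ x ]) ×-dec nonempty? (Γ₁ x ∩ Γ₁ z)

  Γ₂ : Vertex → Subset order
  Γ₂ x = comprehension (isSecond? x)

  ∈Γ₂⁺ : ∀ {x y z} → z ∉ Γ₁[ x ] → y ∈ Γ₁ x → y ∈ Γ₁ z → z ∈ Γ₂ x
  ∈Γ₂⁺ {x} z∉ y∈x y∈z = ∈-comprehension⁺ (isSecond? x) (z∉ , _ , x∈p∩q⁺ (y∈x , y∈z))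

  ∈Γ₂⇒∉Γ₁[] : ∀ {x z} → z ∈ Γ₂ x → z ∉ Γ₁[ x ]
  ∈Γ₂⇒∉Γ₁[] {x} = proj₁ ∘ ∈-comprehension⁻ (isSecond? x)

  distance₂ : ∀ {x z} → z ∈ Γ₂ x → Distance Γ x z 2
  distance₂ {x} {z} z∈ with ∈-comprehension⁻ (isSecond? x) z∈
  ... | z∉ , y , y∈ with x∈p∩q⁻ (Γ₁ x) (Γ₁ z) y∈
  ... | y∈x , y∈z = (∈⇒~ y∈x ∷ (~-sym (∈⇒~ y∈z) ∷ [])) , shortest
    where
    shortest : ∀ j → j < 2 → ¬ Walk Γ j x z
    shortest zero          _             []         = z∉ x∈Γ₁[x]
    shortest (suc zero)    _             (x~z ∷ []) = z∉ (Γ₁⊆Γ₁[] (~⇒∈ x~z))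
    shortest (suc (suc _)) (s≤s (s≤s ())) _

  distance₂⁻ : ∀ {x z} → Distance Γ x z 2 → z ∈ Γ₂ x
  distance₂⁻ {x} {z} (x~y ∷ (y~z ∷ []) , shortest) = ∈Γ₂⁺ z∉ (~⇒∈ x~y) (Γ₁-sym (~⇒∈ y~z))
    where
    z∉ : z ∉ Γ₁[ x ]
    z∉ z∈ with ∈Γ₁[]⁻ z∈
    ... | inj₁ refl = shortest 0 (s≤s z≤n) []
    ... | inj₂ z∈Γ₁ = shortest 1 (s≤s (s≤s z≤n)) (∈⇒~ z∈Γ₁ ∷ [])

  ∣Γ₁∣≡55 : ∀ x → ∣ Γ₁ x ∣ ≡ 55
  ∣Γ₁∣≡55 x = HasCount⇒∣∣≡ (b-count zero x x distance₀) (Γ₁ x)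
    (λ z∈ → ∈⇒~ z∈ , distance₁ (∈⇒~ z∈)) (~⇒∈ ∘ proj₁)

  ∣Γ₂∩Γ₁∣≡36 : ∀ {x y} → y ∈ Γ₁ x → ∣ Γ₂ x ∩ Γ₁ y ∣ ≡ 36
  ∣Γ₂∩Γ₁∣≡36 {x} {y} y∈ = HasCount⇒∣∣≡ (b-count (suc zero) x y (distance₁ (∈⇒~ y∈))) (Γ₂ x ∩ Γ₁ y)
    (λ z∈ → let z∈Γ₂ , z∈Γ₁ = x∈p∩q⁻ (Γ₂ x) (Γ₁ y) z∈ in ∈⇒~ z∈Γ₁ , distance₂ z∈Γ₂)
    (λ (y~z , d) → x∈p∩q⁺ (distance₂⁻ d , ~⇒∈ y~z))

  ∣Γ₁∩Γ₁∣≡4 : ∀ {x z} → z ∈ Γ₂ x → ∣ Γ₁ x ∩ Γ₁ z ∣ ≡ 4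
  ∣Γ₁∩Γ₁∣≡4 {x} {z} z∈ =
    HasCount⇒∣∣≡ (c-count (suc (suc zero)) x z (distance₂ z∈)) (Γ₁ x ∩ Γ₁ z)
      (λ y∈ → let y∈x , y∈z = x∈p∩q⁻ (Γ₁ x) (Γ₁ z) y∈
              in ∈⇒~ y∈z , 1 , refl , distance₁ (∈⇒~ y∈x))
      (λ { (z~y , _ , refl , d) → x∈p∩q⁺ (~⇒∈ (distance₁⁻ d) , ~⇒∈ z~y) })

  -- Counts the edges between `Γ₂ x` and `Γ₁ x`: each vertex of the former is on 4 of them and each
  -- of the 55 vertices of the latter on 36, and 36 · 55 = 1980.
  4∣Γ₂∣≤1980 : ∀ x → 4 * ∣ Γ₂ x ∣ ≤ 1980
  4∣Γ₂∣≤1980 x = subst (λ k → 4 * ∣ Γ₂ x ∣ ≤ 36 * k) (∣Γ₁∣≡55 x)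
    (double-counting Γ₁ Γ₁ Γ₁-sym Γ₁-sym (Γ₂ x) (Γ₁ x)
      (≤-reflexive ∘ sym ∘ ∣Γ₁∩Γ₁∣≡4) (≤-reflexive ∘ ∣Γ₂∩Γ₁∣≡36))

  -- Of the 56 vertices of `Γ₁[ y ]`, 36 are at distance 2 from `x`; the others lie in `Γ₁[ x ]`.
  -- The 20 include `x` and `y`, leaving 18 common neighbours.
  ∣Γ₁[]∩Γ₁[]∣≡20 : ∀ {x y} → y ∈ Γ₁ x → ∣ Γ₁[ x ] ∩ Γ₁[ y ] ∣ ≡ 20
  ∣Γ₁[]∩Γ₁[]∣≡20 {x} {y} y∈ = +-cancelˡ-≡ 36 _ _ (begin
    36 + ∣ common ∣                 ≡⟨ cong (_+ ∣ common ∣) (∣Γ₂∩Γ₁∣≡36 y∈) ⟨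
    ∣ Γ₂ x ∩ Γ₁ y ∣ + ∣ common ∣    ≡⟨ ∣disjoint-∪∣ (Γ₂ x ∩ Γ₁ y) common disjoint ⟨
    ∣ (Γ₂ x ∩ Γ₁ y) ∪ common ∣      ≡⟨ cong ∣_∣ (⊆-antisym split⁻ split⁺) ⟩
    ∣ Γ₁[ y ] ∣                     ≡⟨ ∣⁅x⁆∪p∣ x∉Γ₁x ⟩
    suc ∣ Γ₁ y ∣                    ≡⟨ cong suc (∣Γ₁∣≡55 y) ⟩
    56                              ∎)
    where
    open ≡-Reasoning
    common : Subset order
    common = Γ₁[ x ] ∩ Γ₁[ y ]
    disjoint : ∀ {z} → z ∈ Γ₂ x ∩ Γ₁ y → z ∉ common
    disjoint z∈ z∈′ = ∈Γ₂⇒∉Γ₁[] (p∩q⊆p (Γ₂ x) (Γ₁ y) z∈) (p∩q⊆p Γ₁[ x ] Γ₁[ y ] z∈′)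
    split⁻ : (Γ₂ x ∩ Γ₁ y) ∪ common ⊆ Γ₁[ y ]
    split⁻ z∈ = [ Γ₁⊆Γ₁[] ∘ p∩q⊆q (Γ₂ x) (Γ₁ y) , p∩q⊆q Γ₁[ x ] Γ₁[ y ] ]′
                  (x∈p∪q⁻ (Γ₂ x ∩ Γ₁ y) common z∈)
    split⁺ : Γ₁[ y ] ⊆ (Γ₂ x ∩ Γ₁ y) ∪ common
    split⁺ {z} z∈y with z ∈? Γ₁[ x ] | ∈Γ₁[]⁻ z∈y
    ... | yes z∈x | _           = x∈p∪q⁺ {p = Γ₂ x ∩ Γ₁ y} (inj₂ (x∈p∩q⁺ (z∈x , z∈y)))
    ... | no z∉x  | inj₁ refl   = contradiction (Γ₁⊆Γ₁[] y∈) z∉x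
    ... | no z∉x  | inj₂ z∈Γ₁y  =
      x∈p∪q⁺ (inj₁ (x∈p∩q⁺ (∈Γ₂⁺ z∉x y∈ (Γ₁-sym z∈Γ₁y) , z∈Γ₁y)))

  -- The local graph at a vertex, and the contradiction

  module _ (x : Vertex) where

    N : Vertex → Subset order
    N y = Γ₁ x ∩ Γ₁[ y ]

    ∈N⁻ : ∀ {y z} → z ∈ N y → z ∈ Γ₁ x × z ∈ Γ₁[ y ]
    ∈N⁻ {y} = x∈p∩q⁻ (Γ₁ x) Γ₁[ y ]

    x∉N : ∀ {y} → x ∉ N y
    x∉N = x∉Γ₁x ∘ proj₁ ∘ ∈N⁻

    -- Among the 20 vertices of `Γ₁[ x ] ∩ Γ₁[ y ]`, only `x` is missing from `N y`.
    ∣N∣≡19 : ∀ {y} → y ∈ Γ₁ x → ∣ N y ∣ ≡ 19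
    ∣N∣≡19 {y} y∈ = suc-injective (begin
      suc ∣ N y ∣               ≡⟨ ∣⁅x⁆∪p∣ x∉N ⟨
      ∣ ⁅ x ⁆ ∪ N y ∣           ≡⟨ cong ∣_∣ (⊆-antisym ⊆common common⊆) ⟩
      ∣ Γ₁[ x ] ∩ Γ₁[ y ] ∣     ≡⟨ ∣Γ₁[]∩Γ₁[]∣≡20 y∈ ⟩
      20                        ∎)
      where
      open ≡-Reasoning
      ⊆common : ⁅ x ⁆ ∪ N y ⊆ Γ₁[ x ] ∩ Γ₁[ y ]
      ⊆common z∈ with x∈p∪q⁻ ⁅ x ⁆ (N y) z∈
      ... | inj₁ z∈⁅x⁆ rewrite x∈⁅y⁆⇒x≡y x z∈⁅x⁆ = x∈p∩q⁺ (x∈Γ₁[x] , Γ₁⊆Γ₁[] (Γ₁-sym y∈))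
      ... | inj₂ z∈N = let z∈x , z∈y = ∈N⁻ z∈N in x∈p∩q⁺ (Γ₁⊆Γ₁[] z∈x , z∈y)
      common⊆ : Γ₁[ x ] ∩ Γ₁[ y ] ⊆ ⁅ x ⁆ ∪ N y
      common⊆ z∈ with x∈p∩q⁻ Γ₁[ x ] Γ₁[ y ] z∈
      ... | z∈x , z∈y with x∈p∪q⁻ ⁅ x ⁆ (Γ₁ x) z∈x
      ... | inj₁ z∈⁅x⁆ = x∈p∪q⁺ (inj₁ z∈⁅x⁆)
      ... | inj₂ z∈Γ₁x = x∈p∪q⁺ {p = ⁅ x ⁆} (inj₂ (x∈p∩q⁺ (z∈Γ₁x , z∈y)))

    -- Having the common neighbour `x`, the non-adjacent vertices `y` and `z` are at distance 2, so
    -- they have exactly 4 common neighbours; one of these is `x` itself, which is not in the local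
    -- graph.
    ∣N∩N∣≤3 : ∀ {y z} → y ∈ Γ₁ x → z ∈ Γ₁ x → z ∉ N y → ∣ N y ∩ N z ∣ ≤ 3
    ∣N∩N∣≤3 {y} {z} y∈ z∈ z∉N = ≤-pred (begin
      suc ∣ N y ∩ N z ∣          ≡⟨ ∣⁅x⁆∪p∣ (x∉N ∘ p∩q⊆p (N y) (N z)) ⟨
      ∣ ⁅ x ⁆ ∪ (N y ∩ N z) ∣    ≤⟨ p⊆q⇒∣p∣≤∣q∣ ⊆common ⟩
      ∣ Γ₁ y ∩ Γ₁ z ∣            ≡⟨ ∣Γ₁∩Γ₁∣≡4 (∈Γ₂⁺ z∉y (Γ₁-sym y∈) (Γ₁-sym z∈)) ⟩
      4                          ∎)
      where
      open ≤-Reasoning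
      z∉y : z ∉ Γ₁[ y ]
      z∉y z∈y = z∉N (x∈p∩q⁺ (z∈ , z∈y))
      ⊆common : ⁅ x ⁆ ∪ (N y ∩ N z) ⊆ Γ₁ y ∩ Γ₁ z
      ⊆common v∈ with x∈p∪q⁻ ⁅ x ⁆ (N y ∩ N z) v∈
      ... | inj₁ v∈⁅x⁆ rewrite x∈⁅y⁆⇒x≡y x v∈⁅x⁆ = x∈p∩q⁺ (Γ₁-sym y∈ , Γ₁-sym z∈)
      ... | inj₂ v∈N with x∈p∩q⁻ (N y) (N z) v∈N
      ... | v∈Ny , v∈Nz with ∈Γ₁[]⁻ (proj₂ (∈N⁻ v∈Ny)) | ∈Γ₁[]⁻ (proj₂ (∈N⁻ v∈Nz))
      -- Passing from closed to open neighbourhoods loses nothing: if `y` or `z` were the common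
      -- element, then `z` would lie in `Γ₁[ y ]`.
      ... | inj₁ refl | _         = contradiction (Γ₁[]-sym (proj₂ (∈N⁻ v∈Nz))) z∉y
      ... | inj₂ _    | inj₁ refl = contradiction (proj₂ (∈N⁻ v∈Ny)) z∉y
      ... | inj₂ v∈y  | inj₂ v∈z  = x∈p∩q⁺ (v∈y , v∈z)

    open LocalGraph (Γ₁ x) N
      (λ y → p∩q⊆p (Γ₁ x) Γ₁[ y ])
      (λ y∈ → x∈p∩q⁺ (y∈ , x∈Γ₁[x]))
      (λ y∈ z∈ → x∈p∩q⁺ (y∈ , Γ₁[]-sym (proj₂ (∈N⁻ z∈))))
      (∣Γ₁∣≡55 x) ∣N∣≡19 ∣N∩N∣≤3

    -- Two neighbours w, w′ ∈ S of z would have all of S ∪ {x, z} in their closed neighbourhoods.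
    ∣S∩Γ₁∣≤1 : ∀ {S z} → Clique S → 19 ≤ ∣ S ∣ → z ∈ Γ₂ x → ∣ S ∩ Γ₁ z ∣ ≤ 1
    ∣S∩Γ₁∣≤1 {S} {z} (S⊆Γ₁x , S-adj) 19≤∣S∣ z∈Γ₂ = subsingleton⇒∣∣≤1 (S ∩ Γ₁ z) unique
      where
      open ≤-Reasoning
      K : Subset order
      K = ⁅ x ⁆ ∪ (⁅ z ⁆ ∪ S)
      z∉S : z ∉ S
      z∉S z∈S = ∈Γ₂⇒∉Γ₁[] z∈Γ₂ (Γ₁⊆Γ₁[] (S⊆Γ₁x z∈S))
      x∉⁅z⁆∪S : x ∉ ⁅ z ⁆ ∪ S
      x∉⁅z⁆∪S x∈ with x∈p∪q⁻ ⁅ z ⁆ S x∈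
      ... | inj₁ x∈⁅z⁆ = ∈Γ₂⇒∉Γ₁[] z∈Γ₂ (subst (_∈ Γ₁[ x ]) (x∈⁅y⁆⇒x≡y z x∈⁅z⁆) x∈Γ₁[x])
      ... | inj₂ x∈S   = x∉Γ₁x (S⊆Γ₁x x∈S)
      K⊆ : ∀ {w} → w ∈ S → w ∈ Γ₁ z → K ⊆ Γ₁[ w ]
      K⊆ w∈S w∈Γ₁z v∈ with x∈p∪q⁻ ⁅ x ⁆ (⁅ z ⁆ ∪ S) v∈
      ... | inj₁ v∈⁅x⁆ rewrite x∈⁅y⁆⇒x≡y x v∈⁅x⁆ = Γ₁⊆Γ₁[] (Γ₁-sym (S⊆Γ₁x w∈S))
      ... | inj₂ v∈′ with x∈p∪q⁻ ⁅ z ⁆ S v∈′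
      ... | inj₁ v∈⁅z⁆ rewrite x∈⁅y⁆⇒x≡y z v∈⁅z⁆ = Γ₁⊆Γ₁[] (Γ₁-sym w∈Γ₁z)
      ... | inj₂ v∈S = proj₂ (∈N⁻ (S-adj w∈S v∈S))
      unique : ∀ {w w′} → w ∈ S ∩ Γ₁ z → w′ ∈ S ∩ Γ₁ z → w ≡ w′
      unique {w} {w′} w∈ w′∈ with x∈p∩q⁻ S (Γ₁ z) w∈ | x∈p∩q⁻ S (Γ₁ z) w′∈
      ... | w∈S , w∈z | w′∈S , w′∈z with ∈Γ₁[]⁻ (proj₂ (∈N⁻ (S-adj w′∈S w∈S)))
      ... | inj₁ w≡w′ = w≡w′
      ... | inj₂ w∈w′ = contradiction (begin
        21                        ≤⟨ s≤s (s≤s 19≤∣S∣) ⟩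
        suc (suc ∣ S ∣)           ≡⟨ cong suc (∣⁅x⁆∪p∣ z∉S) ⟨
        suc ∣ ⁅ z ⁆ ∪ S ∣         ≡⟨ ∣⁅x⁆∪p∣ x∉⁅z⁆∪S ⟨
        ∣ K ∣                     ≤⟨ p⊆q⇒∣p∣≤∣q∣ (λ v∈ →
                                       x∈p∩q⁺ (K⊆ w′∈S w′∈z v∈ , K⊆ w∈S w∈z v∈)) ⟩
        ∣ Γ₁[ w′ ] ∩ Γ₁[ w ] ∣    ≡⟨ ∣Γ₁[]∩Γ₁[]∣≡20 w∈w′ ⟩
        20                        ∎) (<⇒≱ ≤-refl)

    no-large-clique : ¬ LargeClique
    -- 1981 + 755 = 2736 = 4 · 36 · 19. The factor 4 replaces the division of 1980 by 4 in the bound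
    -- on `∣ Γ₂ x ∣`.
    no-large-clique (S , clS , 19≤∣S∣) = <⇒≱ (m≤m+n 1981 755) (begin
      4 * (36 * 19)             ≤⟨ *-monoʳ-≤ 4 (*-monoʳ-≤ 36 19≤∣S∣) ⟩
      4 * (36 * ∣ S ∣)          ≤⟨ *-monoʳ-≤ 4 (double-counting Γ₁ Γ₁ Γ₁-sym Γ₁-sym S (Γ₂ x)
                                     (≤-reflexive ∘ sym ∘ ∣Γ₂∩Γ₁∣≡36 ∘ proj₁ clS)
                                     (∣S∩Γ₁∣≤1 clS 19≤∣S∣)) ⟩
      4 * (1 * ∣ Γ₂ x ∣)        ≡⟨ cong (4 *_) (*-identityˡ ∣ Γ₂ x ∣) ⟩
      4 * ∣ Γ₂ x ∣              ≤⟨ 4∣Γ₂∣≤1980 x ⟩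
      1980                      ∎)
      where open ≤-Reasoning

    no-vertex : ⊥
    no-vertex = no-large-clique large-clique

theorem1p4 : ¬ (∃ λ (Γ : Graph) → IsDistanceRegular Γ (55 ∷ 36 ∷ 11 ∷ []) (1 ∷ 4 ∷ 45 ∷ []))
-- The pair at distance 3 contained in `diameter` supplies the vertex; connectedness alone would
-- also hold for the empty graph.
theorem1p4 (Γ , isDR) = no-vertex Γ isDR (proj₁ (proj₂ (IsDistanceRegular.diameter isDR)))
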